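{- Let $w$ be a uniformly recurrent infinite word over a finite alphabet, and let $A=\{u_1,u_2,\ldots,u_n,\ldots\}$ be an infinite family of pairwise different non-empty factors of $w$ such that for every finite subset $\{v_1,\ldots,v_k\}\subseteq A$ (with the $v_i$ distinct) and every permutation $\sigma$ of $\{1,\ldots,k\}$, the word $v_{\sigma(1)}v_{\sigma(2)}\cdots v_{\sigma(k)}$ is a factor of $w$. Then either $w$ is periodic, or the factor complexity of $w$ is greater than linear, i.e. there is no constant $C$ with $p_w(n)\le Cn$ for all $n\ge 1$.
   Context: An infinite word $w$ is uniformly recurrent if every factor of $w$ occurs in $w$ infinitely often with bounded gaps. The factor complexity $p_w(n)$ is the number of distinct factors of $w$ of length $n$. A word $w$ is periodic if $w=u^\omega=uuu\cdots$ for some non-empty finite word $u$. -}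

module Defs where

open import Data.Nat using (ℕ; zero; suc; _+_; _*_; _≤_; NonZero)
open import Data.Nat.DivMod using (_mod_)
open import Data.Fin using (Fin; toℕ)
open import Data.Vec using (Vec; lookup)
open import Data.List using (List; length; tabulate; [])
open import Data.List.Relation.Unary.All using (All)
open import Data.List.Relation.Unary.Unique.Propositional using (Unique)
open import Data.Product using (Σ; ∃; _×_)
open import Relation.Binary.PropositionalEquality using (_≡_)
open import Relation.Nullary using (¬_)

Word : ℕ → Set
Word k = ℕ → Fin k

FinWord : ℕ → Set
FinWord k = List (Fin k)

slice : ∀ {k} → Word k → ℕ → ℕ → FinWord k
slice w i n = tabulate {n = n} (λ j → w (i + toℕ j))

OccursAt : ∀ {k} → Word k → FinWord k → ℕ → Set
OccursAt w u i = slice w i (length u) ≡ u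

Factor : ∀ {k} → Word k → FinWord k → Set
Factor w u = ∃ λ i → OccursAt w u i

UniformlyRecurrent : ∀ {k} → Word k → Set
UniformlyRecurrent w =
  ∀ u → Factor w u → ∃ λ N → ∀ i → ∃ λ j → i ≤ j × j ≤ i + N × OccursAt w u j

omega : ∀ {k m} → Vec (Fin k) (suc m) → Word k
omega {m = m} u i = lookup u (i mod suc m)

Periodic : ∀ {k} → Word k → Set
Periodic {k} w = Σ ℕ λ m → Σ (Vec (Fin k) (suc m)) λ u → ∀ i → w i ≡ omega u i

ComplexityAtMost : ∀ {k} → Word k → ℕ → ℕ → Set
ComplexityAtMost {k} w n M =
  (vs : List (FinWord k)) → Unique vs →
  All (λ v → length v ≡ n × Factor w v) vs → length vs ≤ M

LinearComplexity : ∀ {k} → Word k → Set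
LinearComplexity w = ∃ λ C → ∀ n → 1 ≤ n → ComplexityAtMost w n (C * n)

InFamily : ∀ {k} → (ℕ → FinWord k) → FinWord k → Set
InFamily u v = ∃ λ n → u n ≡ v

{-# OPTIONS --safe #-}
-- Suppose p_w(n) ≤ C n and w is not periodic. By uniform recurrence, for every m the factors with a
-- period in 1..m have bounded length. Take D = C + 2 family members u i and a long further member v′:
-- no z i = u i ++ v′ is a prefix of another, since otherwise v′ would have a short period. So the
-- prefix tree of the z i has D - 1 branchings. For large n pick a family member v of length ≥ n:
-- the branchings, read after v, give right special factors of length n, different branchings giving
-- different factors because v has no long suffix with a short period. Hence
-- p_w(n + 1) ≥ p_w(n) + C + 1 for all large n, a contradiction.
module Submission where

open import Defs
open import Data.Nat using (ℕ; zero; suc; _+_; _*_; _∸_; _⊔_; _≤_; _<_; z≤n; s≤s)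
open import Data.Nat.Properties
open import Data.Nat.DivMod using (_mod_; _%_; _/_; m≡m%n+[m/n]*n; m%n<n)
open import Data.Fin using (Fin; toℕ)
open import Data.Fin.Properties using (toℕ-fromℕ<) renaming (_≟_ to _≟ᶠ_)
open import Data.Vec as Vec using ()
open import Data.Vec.Properties using (lookup∘tabulate)
open import Data.List using (List; concat; []; _∷_; _++_; _∷ʳ_; [_]; length; map; take; drop; applyUpTo; allFin; cartesianProductWith)
open import Data.List.Properties
  using (++-assoc; ++-identityʳ; length-++; length-map; length-drop; length-take; length-tabulate; length-applyUpTo; tabulate-cong; take++drop≡id; ∷-injective; ∷ʳ-injectiveˡ; ≡-dec)
open import Data.List.Relation.Unary.All as All using (All; []; _∷_)
import Data.List.Relation.Unary.All.Properties as All
open import Data.List.Relation.Unary.Any as Any using (Any; here; there; any?)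
import Data.List.Relation.Unary.Any.Properties as Any
open import Data.List.Relation.Unary.AllPairs using (AllPairs; []; _∷_)
import Data.List.Relation.Unary.AllPairs.Properties as AllPairs
open import Data.List.Relation.Unary.Unique.Propositional using (Unique)
import Data.List.Relation.Unary.Unique.Propositional.Properties as Unique
open import Data.List.Relation.Binary.Pointwise using (Pointwise-≡⇒≡)
open import Data.List.Relation.Binary.Prefix.Heterogeneous using (Prefix; []; _∷_; toView) renaming (_++_ to _++ᵛ_)
open import Data.List.Relation.Binary.Prefix.Heterogeneous.Properties using (prefix?)
open import Data.List.Membership.Propositional using (_∈_; _∉_)
open import Data.List.Membership.Propositional.Properties using (finite; ∈-cartesianProductWith⁺; ∈-allFin; ∈-map⁻)
open import Data.Product using (∃; ∃₂; _×_; _,_; proj₁; proj₂)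
open import Data.Sum using (_⊎_; inj₁; inj₂)
open import Relation.Binary.PropositionalEquality using (_≡_; _≢_; refl; sym; trans; cong; cong₂; subst; module ≡-Reasoning)
open import Relation.Binary.Definitions using (DecidableEquality; tri<; tri≈; tri>)
open import Relation.Nullary using (¬_; yes; no; contradiction)
open import Relation.Nullary.Decidable using (decidable-stable)
open import Relation.Unary using (Decidable)
open import Function using (_∘_)
open import Function.Bundles using (mk↣)
open import Function.Definitions using (Injective)

-- Factorisations, suffixes and prefixes of finite words.

module _ {A : Set} where

  -- Levi's lemma, in the case where the first factorisation has the shorter left part.
  ++-split : ∀ (a {b} c {d} : List A) → a ++ b ≡ c ++ d → length a ≤ length c →
             ∃ λ t → a ++ t ≡ c × b ≡ t ++ d
  ++-split []      c       eq _         = c , refl , eq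
  ++-split (x ∷ a) (y ∷ c) eq (s≤s a≤c) with ∷-injective eq
  ... | refl , eq′ with ++-split a c eq′ a≤c
  ...   | t , p , q = t , cong (x ∷_) p , q

  ++-injective : ∀ (a {b} c {d} : List A) → a ++ b ≡ c ++ d → length a ≡ length c →
                 a ≡ c × b ≡ d
  ++-injective []      []      eq _  = refl , eq
  ++-injective (x ∷ a) (y ∷ c) eq le with ∷-injective eq
  ... | refl , eq′ with ++-injective a c eq′ (suc-injective le)
  ...   | refl , q = refl , q

  length-∷ʳ : ∀ (a : List A) {x} → length (a ∷ʳ x) ≡ suc (length a)
  length-∷ʳ a = trans (length-++ a) (+-comm (length a) 1)

  unique-map : ∀ {B : Set} {P : A → Set} {f : A → B} →
               (∀ {x y} → P x → P y → f x ≡ f y → x ≡ y) →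
               ∀ {xs} → All P xs → Unique xs → Unique (map f xs)
  unique-map inj []         []         = []
  unique-map inj (px ∷ pxs) (x∉ ∷ uxs) =
    All.map⁺ (All.zipWith (λ (py , x≢y) → x≢y ∘ inj px py) (pxs , x∉)) ∷ unique-map inj pxs uxs

  lastLetters : ℕ → List A → List A
  lastLetters j v = drop (length v ∸ j) v

  length-lastLetters : ∀ {j} (v : List A) → j ≤ length v → length (lastLetters j v) ≡ j
  length-lastLetters {j} v j≤v =
    trans (length-drop (length v ∸ j) v) (m∸[m∸n]≡n j≤v)

  lastLetters-split : ∀ {i j} (v : List A) → i ≤ j → j ≤ length v →
                      ∃ λ f → lastLetters j v ≡ f ++ lastLetters i v × length f + i ≡ j
  lastLetters-split {i} {j} v i≤j j≤v =
    let f , _ , eq = ++-split (take (length v ∸ j) v) (take (length v ∸ i) v)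
                       (trans (take++drop≡id (length v ∸ j) v) (sym (take++drop≡id (length v ∸ i) v)))
                       takes
    in f , eq , (begin-equality
      length f + i                             ≡⟨ cong (length f +_) (length-lastLetters v (≤-trans i≤j j≤v)) ⟨
      length f + length (lastLetters i v)      ≡⟨ length-++ f ⟨
      length (f ++ lastLetters i v)            ≡⟨ cong length eq ⟨
      length (lastLetters j v)                 ≡⟨ length-lastLetters v j≤v ⟩
      j                                        ∎)
    where
    open ≤-Reasoning
    length-prefix : ∀ n → length (take (length v ∸ n) v) ≡ length v ∸ n
    length-prefix n = trans (length-take (length v ∸ n) v) (m≤n⇒m⊓n≡m (m∸n≤m (length v) n))
    takes : length (take (length v ∸ j) v) ≤ length (take (length v ∸ i) v)
    takes = begin
      length (take (length v ∸ j) v)   ≡⟨ length-prefix j ⟩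
      length v ∸ j                     ≤⟨ ∸-monoʳ-≤ (length v) i≤j ⟩
      length v ∸ i                     ≡⟨ length-prefix i ⟨
      length (take (length v ∸ i) v)   ∎

  -- The suffix of length suc n of v ++ e, provided that 0 < length e ≤ suc n and n ≤ length v.
  complete : ℕ → List A → List A → List A
  complete n v e = lastLetters (suc n ∸ length e) v ++ e

  length-complete : ∀ {n} v e → n ≤ length v → 0 < length e → length e ≤ suc n →
                    length (complete n v e) ≡ suc n
  length-complete {n} v e n≤v 0<e e≤n =
    trans (length-++ (lastLetters (suc n ∸ length e) v))
      (trans (cong (_+ length e) (length-lastLetters v (≤-trans (∸-monoʳ-≤ (suc n) 0<e) n≤v)))
        (m∸n+n≡m e≤n))

  -- What precedes the last letter depends on `p` alone. Edges leaving one node `p` of a prefix tree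
  -- thus become right extensions of one and the same word.
  complete-∷ʳ : ∀ n v p c → complete n v (p ∷ʳ c) ≡ (lastLetters (n ∸ length p) v ++ p) ∷ʳ c
  complete-∷ʳ n v p c = trans (cong (λ l → lastLetters (suc n ∸ l) v ++ p ∷ʳ c) (length-∷ʳ p))
                              (sym (++-assoc (lastLetters (n ∸ length p) v) p [ c ]))

  infix 4 _≼_

  _≼_ : List A → List A → Set
  _≼_ = Prefix _≡_

  ≼⇒++ : ∀ {a b} → a ≼ b → ∃ λ t → a ++ t ≡ b
  ≼⇒++ a≼b with toView a≼b
  ... | pw ++ᵛ t = t , cong (_++ t) (Pointwise-≡⇒≡ pw)

  ≼-∷ʳ : ∀ {p b} → p ≼ b → p ≢ b → ∃ λ c → p ∷ʳ c ≼ b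
  ≼-∷ʳ {b = []}    []           p≢b = contradiction refl p≢b
  ≼-∷ʳ {b = x ∷ _} []           p≢b = x , refl ∷ []
  ≼-∷ʳ             (refl ∷ p≼b) p≢b with ≼-∷ʳ p≼b (p≢b ∘ cong (_ ∷_))
  ... | c , q = c , refl ∷ q

  -- Reading `z` letter by letter from `[]`, some letter must lose `P`. With `P` saying "prefix of
  -- one of the other words", this is the place where `z` leaves their prefix tree.
  first-failure : ∀ {P : List A → Set} → Decidable P → P [] → ∀ z → ¬ P z →
                  ∃₂ λ p c → P p × ¬ P (p ∷ʳ c) × p ∷ʳ c ≼ z
  first-failure P? P[] []      ¬Pz = contradiction P[] ¬Pz
  first-failure P? P[] (x ∷ z) ¬Pz with P? [ x ]
  ... | no  ¬Px = [] , x , P[] , ¬Px , refl ∷ []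
  ... | yes Px with first-failure (P? ∘ (x ∷_)) Px z ¬Pz
  ...   | p , c , Pp , ¬Ppc , pc≼z = x ∷ p , c , Pp , ¬Ppc , refl ∷ pc≼z

  PrefixOfSome : List (List A) → List A → Set
  PrefixOfSome zs e = Any (e ≼_) zs

  Incomparable : List A → List A → Set
  Incomparable a b = ¬ a ≼ b × ¬ b ≼ a

  -- A word stands for the tree edge labelled by its last letter. The sibling edge leaves the same
  -- node and is not listed in `es`. A node with d outgoing edges can therefore have at most d - 1
  -- of them listed, and an unlisted one is left as default extension.
  Sibling : List (List A) → (List A → Set) → List A → Set
  Sibling es P e = ∃₂ λ p c → e ≡ p ∷ʳ c × ∃ λ c′ → p ∷ʳ c′ ∉ es × P (p ∷ʳ c′)

-- Branchings in the prefix tree of finitely many words.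

module _ {k : ℕ} where

  _≟ʷ_ : DecidableEquality (FinWord k)
  _≟ʷ_ = ≡-dec _≟ᶠ_

  open import Data.List.Membership.DecPropositional _≟ʷ_ using (_∈?_)

  -- A new word leaves the prefix tree of the others along exactly one new edge.
  branches : ∀ (z : FinWord k) zs → AllPairs Incomparable (z ∷ zs) →
             ∃ λ es → Unique es × length es ≡ length zs ×
               All (PrefixOfSome (z ∷ zs)) es × All (Sibling es (PrefixOfSome (z ∷ zs))) es
  branches z []           _           = [] , [] , refl , [] , []
  branches z (z′ ∷ zs) (z# ∷ zs#)
    with branches z′ zs zs#
       | first-failure (λ e → any? (prefix? _≟ᶠ_ e) (z′ ∷ zs)) (here []) z
           (λ z≼ → All.All¬⇒¬Any (All.map proj₁ z#) z≼)
  ... | es , es! , len , es≼ , es-branch | p , c , p≼ , pc⋠ , pc≼z =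
    p ∷ʳ c ∷ es , All.map (λ e≼ pc≡e → pc⋠ (subst (PrefixOfSome _) (sym pc≡e) e≼)) es≼ ∷ es! , cong suc len ,
    here pc≼z ∷ All.map there es≼ ,
    new-branch ∷ All.map lift es-branch
    where
    lift : ∀ {e} → Sibling es (PrefixOfSome (z′ ∷ zs)) e → Sibling (p ∷ʳ c ∷ es) (PrefixOfSome (z ∷ z′ ∷ zs)) e
    lift (q , d , eq , d′ , qd′∉ , qd′≼) =
      q , d , eq , d′ ,
      (λ { (here qd′≡pc) → pc⋠ (subst (PrefixOfSome _) qd′≡pc qd′≼)
         ; (there qd′∈)  → qd′∉ qd′∈ }) ,
      there qd′≼
    p≼z : p ≼ z
    p≼z with ≼⇒++ pc≼z
    ... | t , refl = subst (p ≼_) (sym (++-assoc p [ c ] t)) (self p)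
      where
      self : ∀ (p : FinWord k) {t} → p ≼ p ++ t
      self []      = []
      self (x ∷ p) = refl ∷ self p
    other : ∀ {zs} → All (Incomparable z) zs → PrefixOfSome zs p → ∃ λ c′ → PrefixOfSome zs (p ∷ʳ c′)
    -- The word `y` continues beyond `p`, since `y = p` would be a prefix of `z`.
    other ((_ , y⋠z) ∷ _) (here p≼y) with ≼-∷ʳ p≼y (λ { refl → y⋠z p≼z })
    ... | c′ , pc′≼y = c′ , here pc′≼y
    other (_ ∷ ys#) (there p≼) with other ys# p≼
    ... | c′ , pc′≼ = c′ , there pc′≼
    new-branch : Sibling (p ∷ʳ c ∷ es) (PrefixOfSome (z ∷ z′ ∷ zs)) (p ∷ʳ c)
    new-branch with other z# p≼
    ... | c′ , pc′≼ with (p ∷ʳ c′) ∈? es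
    ...   | no pc′∉ = p , c , refl , c′ ,
      (λ { (here pc′≡pc) → pc⋠ (subst (PrefixOfSome _) pc′≡pc pc′≼)
         ; (there pc′∈)  → pc′∉ pc′∈ }) ,
      there pc′≼
    -- A listed edge brings its own unlisted sibling. It leaves the same node `p`, so it serves for
    -- `c` as well.
    ...   | yes pc′∈ with lift (All.lookup es-branch pc′∈)
    ...     | q , d , eq , rest with ∷ʳ-injectiveˡ p q eq
    ...       | refl = p , c , refl , rest

  -- Long members of an infinite family of words.

  wordsUpTo : ℕ → List (FinWord k)
  wordsUpTo zero    = [ [] ]
  wordsUpTo (suc n) = [] ∷ cartesianProductWith _∷_ (allFin k) (wordsUpTo n)

  ∈-wordsUpTo : ∀ {n} (v : FinWord k) → length v ≤ n → v ∈ wordsUpTo n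
  ∈-wordsUpTo {zero}  []      _         = here refl
  ∈-wordsUpTo {suc n} []      _         = here refl
  ∈-wordsUpTo {suc n} (x ∷ v) (s≤s v≤n) =
    there (∈-cartesianProductWith⁺ _∷_ (∈-allFin x) (∈-wordsUpTo v v≤n))

  -- If no member from index `i` on had length at least `n`, ℕ would inject into a finite list of
  -- words. The argument only refutes, hence the double negation; it does no harm, because the final
  -- goal is a negation.
  long-word : ∀ (u : ℕ → FinWord k) → Injective _≡_ _≡_ u → ∀ i n →
              ¬ ¬ ∃ λ j → i ≤ j × n ≤ length (u j)
  long-word u u-inj i n ¬long =
    finite (mk↣ {to = λ j → u (i + j)} (+-cancelˡ-≡ i _ _ ∘ u-inj)) (wordsUpTo n)
      (λ j → ∈-wordsUpTo _ (≰⇒≥ λ n≤ → ¬long (i + j , m≤m+n i j , n≤)))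

-- Factors of an infinite word.

module _ {k : ℕ} (w : Word k) where

  slice-suc : ∀ i n → slice w i (suc n) ≡ w i ∷ slice w (suc i) n
  slice-suc i n =
    cong₂ _∷_ (cong w (+-identityʳ i)) (tabulate-cong λ j → cong w (+-suc i (toℕ j)))

  slice-+ : ∀ i m n → slice w i (m + n) ≡ slice w i m ++ slice w (i + m) n
  slice-+ i zero    n = cong (λ j → slice w j n) (sym (+-identityʳ i))
  slice-+ i (suc m) n = begin
    slice w i (suc m + n)                               ≡⟨ slice-suc i (m + n) ⟩
    w i ∷ slice w (suc i) (m + n)                       ≡⟨ cong (w i ∷_) (slice-+ (suc i) m n) ⟩
    w i ∷ slice w (suc i) m ++ slice w (suc i + m) n    ≡⟨ cong₂ (λ a j → a ++ slice w j n) (slice-suc i m) (+-suc i m) ⟨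
    slice w i (suc m) ++ slice w (i + suc m) n          ∎
    where open ≡-Reasoning

  length-slice : ∀ i n → length (slice w i n) ≡ n
  length-slice i n = length-tabulate _

  slice-injective : ∀ {i j n s} → slice w i n ≡ slice w j n → s < n → w (i + s) ≡ w (j + s)
  slice-injective {i} {j} {suc n} {s} eq s<n
    with ∷-injective (trans (sym (slice-suc i n)) (trans eq (slice-suc j n)))
  slice-injective {i} {j} {suc n} {zero}  eq s<n       | p , _ =
    trans (cong w (+-identityʳ i)) (trans p (cong w (sym (+-identityʳ j))))
  slice-injective {i} {j} {suc n} {suc s} eq (s≤s s<n) | _ , q =
    trans (cong w (+-suc i s)) (trans (slice-injective q s<n) (cong w (sym (+-suc j s))))

  factor-slice : ∀ i n → Factor w (slice w i n)
  factor-slice i n = i , cong (slice w i) (length-slice i n)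

  factor-++⁻ : ∀ a {b} → Factor w (a ++ b) → Factor w a × Factor w b
  factor-++⁻ a {b} (i , occ)
    with ++-injective (slice w i (length a)) a
           (trans (sym (slice-+ i (length a) (length b))) (trans (cong (slice w i) (sym (length-++ a))) occ))
           (length-slice i (length a))
  ... | p , q = (i , p) , (i + length a , q)

  factor-∷ʳ : ∀ {a} → Factor w a → ∃ λ c → Factor w (a ∷ʳ c)
  -- The `+ 0` is what a slice of length 1 computes to, so the last line of the chain holds
  -- definitionally.
  factor-∷ʳ {a} (i , occ) = w (i + length a + 0) , i , (begin
    slice w i (length (a ∷ʳ _))                           ≡⟨ cong (slice w i) (length-++ a) ⟩
    slice w i (length a + 1)                              ≡⟨ slice-+ i (length a) 1 ⟩
    slice w i (length a) ++ slice w (i + length a) 1      ≡⟨ cong (_++ slice w (i + length a) 1) occ ⟩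
    a ∷ʳ _                                                ∎)
    where open ≡-Reasoning

  -- Periods of factors.

  shift-invariant⇒periodic : ∀ {m} → (∀ i → w i ≡ w (i + suc m)) → Periodic w
  shift-invariant⇒periodic {m} shift = m , Vec.tabulate (w ∘ toℕ) , λ i → begin
    w i                                             ≡⟨ cong w (m≡m%n+[m/n]*n i (suc m)) ⟩
    w (i % suc m + i / suc m * suc m)               ≡⟨ multiple (i % suc m) (i / suc m) ⟨
    w (i % suc m)                                   ≡⟨ cong w (toℕ-fromℕ< (m%n<n i (suc m))) ⟨
    w (toℕ (i mod suc m))                           ≡⟨ lookup∘tabulate (w ∘ toℕ) (i mod suc m) ⟨
    omega (Vec.tabulate (w ∘ toℕ)) i                ∎
    where
    open ≡-Reasoning
    multiple : ∀ r q → w r ≡ w (r + q * suc m)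
    multiple r zero    = cong w (sym (+-identityʳ r))
    multiple r (suc q) = begin
      w r                             ≡⟨ shift r ⟩
      w (r + suc m)                   ≡⟨ multiple (r + suc m) q ⟩
      w (r + suc m + q * suc m)       ≡⟨ cong w (+-assoc r (suc m) (q * suc m)) ⟩
      w (r + (suc m + q * suc m))     ∎

  -- b ++ t ≡ f ++ b says that b has period length f.
  border-shift : ∀ {b f t} i → OccursAt w b i → b ++ t ≡ f ++ b →
                 ∀ {s} → s + length f < length b → w (i + s) ≡ w (i + s + length f)
  border-shift {b} {f} {t} i occ eq {s} s+f<b =
    trans (slice-injective {n = r} (sym (proj₁ inits)) s<r)
          (cong w (trans (+-assoc i d s) (trans (cong (i +_) (+-comm d s)) (sym (+-assoc i s d)))))
    where
    open ≡-Reasoning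
    d = length f
    r = length b ∸ d
    d+r : d + r ≡ length b
    d+r = m+[n∸m]≡n (≤-trans (m≤n+m d s) (<⇒≤ s+f<b))
    s<r : s < r
    s<r = +-cancelʳ-< d s r (≤-trans s+f<b (≤-reflexive (trans (sym d+r) (+-comm d r))))
    b≡ : slice w i d ++ slice w (i + d) r ≡ b
    b≡ = trans (sym (slice-+ i d r)) (trans (cong (slice w i) d+r) occ)
    b≡′ : slice w i r ++ slice w (i + r) d ≡ b
    b≡′ = trans (sym (slice-+ i r d)) (trans (cong (slice w i) (trans (+-comm r d) d+r)) occ)
    -- Cancelling `f` turns `b` without its first `d` letters into a prefix of `b`. Hence the
    -- windows of length `r` at `i` and at `i + d` agree.
    tails : slice w (i + d) r ++ t ≡ b
    tails = proj₂ (++-injective (slice w i d) f (begin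
      slice w i d ++ slice w (i + d) r ++ t      ≡⟨ ++-assoc (slice w i d) _ t ⟨
      (slice w i d ++ slice w (i + d) r) ++ t    ≡⟨ cong (_++ t) b≡ ⟩
      b ++ t                                     ≡⟨ eq ⟩
      f ++ b                                     ∎) (length-slice i d))
    inits : slice w (i + d) r ≡ slice w i r × t ≡ slice w (i + r) d
    inits = ++-injective (slice w (i + d) r) (slice w i r) (trans tails (sym b≡′))
              (trans (length-slice (i + d) r) (sym (length-slice i r)))

  PeriodBound : ℕ → ℕ → Set
  PeriodBound m N = ∀ {b f t} → Factor w b → N ≤ length b →
                    0 < length f → length f ≤ m → b ++ t ≢ f ++ b

  -- Induction on `m` handles the smaller periods. For period `suc m`, non-periodicity yields a
  -- mismatch between letters at distance `suc m`. The slice around it recurs with bounded gaps, so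
  -- every long factor contains a copy of the mismatch and cannot have this period.
  periodBound : UniformlyRecurrent w → ¬ Periodic w → ∀ m → ¬ ¬ ∃ (PeriodBound m)
  periodBound rec ¬per zero    ¬bound = ¬bound (0 , λ _ _ 0<f f≤0 → contradiction (≤-trans 0<f f≤0) λ ())
  periodBound rec ¬per (suc m) ¬bound = periodBound rec ¬per m λ (N , bound) →
    ¬per (shift-invariant⇒periodic λ i → decidable-stable (w i ≟ᶠ w (i + suc m)) λ wi≢ →
      let R , occurs = rec (slice w i (suc (suc m))) (factor-slice i (suc (suc m)))
      -- `N` serves the smaller periods. The rest leaves room for a copy of the mismatch that starts
      -- at most `R` places into `b` and ends `suc m` places later.
      in ¬bound (N + suc (R + suc m) , λ {b} {f} {t} (a , occ) long 0<f f≤m b≡ →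
        let f≮ : ¬ length f < suc m
            f≮ f<m = bound (a , occ) (≤-trans (m≤m+n N _) long) 0<f (≤-pred f<m) b≡
            f≡m = ≤-antisym f≤m (≮⇒≥ f≮)
            j , a≤j , j≤a+R , occ-j = occurs a
            same : slice w i (suc (suc m)) ≡ slice w j (suc (suc m))
            same = sym (trans (cong (slice w j) (sym (length-slice i (suc (suc m))))) occ-j)
            j≡ : a + (j ∸ a) ≡ j
            j≡ = m+[n∸m]≡n a≤j
            s≤R : j ∸ a ≤ R
            s≤R = m≤n+o⇒m∸n≤o j a j≤a+R
            s+f<b : j ∸ a + length f < length b
            s+f<b = ≤-trans (s≤s (+-mono-≤ s≤R f≤m)) (≤-trans (m≤n+m _ N) long)
            open ≡-Reasoning
        in wi≢ (begin
          w i                               ≡⟨ cong w (+-identityʳ i) ⟨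
          w (i + 0)                         ≡⟨ slice-injective same (s≤s z≤n) ⟩
          w (j + 0)                         ≡⟨ cong w (trans (+-identityʳ j) (sym j≡)) ⟩
          w (a + (j ∸ a))                   ≡⟨ border-shift a occ b≡ s+f<b ⟩
          w (a + (j ∸ a) + length f)        ≡⟨ cong w (cong₂ _+_ j≡ f≡m) ⟩
          w (j + suc m)                     ≡⟨ slice-injective same ≤-refl ⟨
          w (i + suc m)                     ∎)))

  -- Right extensions of factors of length `n`.

  FactorOfLength : ℕ → FinWord k → Set
  FactorOfLength n v = length v ≡ n × Factor w v

  open import Data.List.Membership.DecPropositional (_≟ʷ_ {k}) using (_∈?_)

  -- Each `v` takes the letter that follows one of its occurrences; if this extension is listed in
  -- `es`, its unlisted sibling replaces it. Deleting the last letter recovers `v`, so the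
  -- extensions are distinct, and the words in `es` remain free to be counted in addition.
  extend-factors : ∀ {n es} → All (Sibling es (Factor w)) es →
                   ∀ {vs} → Unique vs → All (FactorOfLength n) vs →
                   ∃ λ vs′ → Unique vs′ × All (FactorOfLength (suc n)) vs′ × length vs′ ≡ length vs ×
                     All (λ v′ → v′ ∉ es × ∃₂ λ v c → v ∈ vs × v′ ≡ v ∷ʳ c) vs′
  extend-factors siblings [] [] = [] , [] , [] , refl , []
  extend-factors {n} {es} siblings {v ∷ vs} (v∉ ∷ vs!) ((len , v-factor) ∷ vs-factors)
    with extend-factors siblings vs! vs-factors | extension
    where
    extension : ∃ λ c → v ∷ʳ c ∉ es × Factor w (v ∷ʳ c)
    extension with factor-∷ʳ v-factor
    ... | c , vc-factor with (v ∷ʳ c) ∈? es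
    ...   | no  vc∉ = c , vc∉ , vc-factor
    ...   | yes vc∈ with All.lookup siblings vc∈
    ...     | p , d , eq , rest with ∷ʳ-injectiveˡ v p eq
    ...       | refl = rest
  ... | vs′ , vs′! , vs′-factors , len′ , origins | c , vc∉ , vc-factor =
    v ∷ʳ c ∷ vs′ , All.map fresh origins ∷ vs′! ,
    (trans (length-∷ʳ v) (cong suc len) , vc-factor) ∷ vs′-factors ,
    cong suc len′ ,
    (vc∉ , v , c , here refl , refl) ∷
      All.map (λ (v′∉ , x , d , x∈ , eq) → v′∉ , x , d , there x∈ , eq) origins
    where
    fresh : ∀ {v′} → (v′ ∉ es × ∃₂ λ x d → x ∈ vs × v′ ≡ x ∷ʳ d) → v ∷ʳ c ≢ v′
    fresh (_ , x , d , x∈ , refl) eq = All.lookup v∉ x∈ (∷ʳ-injectiveˡ v x eq)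

  factor-complete : ∀ n v {e} → Factor w (v ++ e) → Factor w (complete n v e)
  factor-complete n v {e} fac =
    proj₂ (factor-++⁻ (take j v) (subst (Factor w) (begin
      v ++ e                            ≡⟨ cong (_++ e) (take++drop≡id j v) ⟨
      (take j v ++ drop j v) ++ e       ≡⟨ ++-assoc (take j v) (drop j v) e ⟩
      take j v ++ drop j v ++ e         ∎) fac))
    where
    open ≡-Reasoning
    j = length v ∸ (suc n ∸ length e)

  -- Let `b` be the suffix of `v` used with the longer `e′`. The shorter `e` is used with a suffix
  -- `f ++ b`. If the completions agree, `b` is a prefix of `f ++ b` and has the period
  -- `length e′ - length e`, which is positive and at most `m`, although `b` has length at least
  -- `N`.
  complete-≢ : ∀ {m N n v} → PeriodBound m N → Factor w v → N + m ≤ n → n ≤ length v →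
               ∀ {e e′} → 0 < length e → length e′ ≤ m → length e < length e′ →
               complete n v e ≢ complete n v e′
  complete-≢ {m} {N} {n} {v} bound v-factor N+m≤n n≤v {e} {e′} 0<e e′≤m e<e′ eq
    with lastLetters-split v (∸-monoʳ-≤ (suc n) (<⇒≤ e<e′)) (≤-trans (∸-monoʳ-≤ (suc n) 0<e) n≤v)
  ... | f , split , f+i≡j with ++-split b (f ++ b) (trans (sym eq) (cong (_++ e) split)) b≤fb
    where
    b = lastLetters (suc n ∸ length e′) v
    b≤fb : length b ≤ length (f ++ b)
    b≤fb = ≤-trans (m≤n+m (length b) (length f)) (≤-reflexive (sym (length-++ f)))
  ... | t , b++t≡f++b , _ = bound b-factor N≤b 0<f f≤m b++t≡f++b
    where
    i = suc n ∸ length e′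
    b = lastLetters i v
    N+e′≤1+n : N + length e′ ≤ suc n
    N+e′≤1+n = ≤-trans (+-monoʳ-≤ N e′≤m) (≤-trans N+m≤n (n≤1+n n))
    e′≤1+n : length e′ ≤ suc n
    e′≤1+n = ≤-trans (m≤n+m _ N) N+e′≤1+n
    b-factor : Factor w b
    b-factor = proj₂ (factor-++⁻ (take (length v ∸ i) v)
                 (subst (Factor w) (sym (take++drop≡id (length v ∸ i) v)) v-factor))
    N≤b : N ≤ length b
    N≤b = ≤-trans (m+n≤o⇒m≤o∸n N N+e′≤1+n)
            (≤-reflexive (sym (length-lastLetters v
              (≤-trans (∸-monoʳ-≤ (suc n) (≤-trans 0<e (<⇒≤ e<e′))) n≤v))))
    f+e≡e′ : length f + length e ≡ length e′
    f+e≡e′ = +-cancelˡ-≡ i _ _ (begin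
      i + (length f + length e)     ≡⟨ +-assoc i (length f) (length e) ⟨
      i + length f + length e       ≡⟨ cong (_+ length e) (trans (+-comm i (length f)) f+i≡j) ⟩
      suc n ∸ length e + length e   ≡⟨ m∸n+n≡m (≤-trans (<⇒≤ e<e′) e′≤1+n) ⟩
      suc n                         ≡⟨ m∸n+n≡m e′≤1+n ⟨
      i + length e′                 ∎)
      where open ≡-Reasoning
    f≤m : length f ≤ m
    f≤m = ≤-trans (m≤m+n (length f) (length e)) (≤-trans (≤-reflexive f+e≡e′) e′≤m)
    0<f : 0 < length f
    0<f = +-cancelʳ-< (length e) 0 (length f) (subst (length e <_) (sym f+e≡e′) e<e′)

  complete-injective : ∀ {m N n v} → PeriodBound m N → Factor w v → N + m ≤ n → n ≤ length v →
                       ∀ {e e′} → 0 < length e × length e ≤ m → 0 < length e′ × length e′ ≤ m →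
                       complete n v e ≡ complete n v e′ → e ≡ e′
  complete-injective {n = n} {v} bound v-factor N+m≤n n≤v {e} {e′} (0<e , e≤m) (0<e′ , e′≤m) eq
    with <-cmp (length e) (length e′)
  ... | tri≈ _ e≡e′ _ = proj₂ (++-injective _ _ eq (cong (λ l → length (lastLetters (suc n ∸ l) v)) e≡e′))
  ... | tri< e<e′ _ _ = contradiction eq (complete-≢ bound v-factor N+m≤n n≤v {e} {e′} 0<e e′≤m e<e′)
  ... | tri> _ _ e>e′ = contradiction (sym eq) (complete-≢ bound v-factor N+m≤n n≤v {e′} {e} 0<e′ e≤m e>e′)

  -- The completed branching edges and the extensions chosen to avoid them are disjoint lists of
  -- factors of length `suc n`. The first contributes one word for each member of `zs`, the second
  -- one for each member of `vs`.
  more-factors : ∀ {m N n v z zs} → PeriodBound m N → N + m ≤ n → n ≤ length v → Factor w v →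
                 AllPairs Incomparable (z ∷ zs) →
                 (∀ {e} → PrefixOfSome (z ∷ zs) e → length e ≤ m × Factor w (v ++ e)) →
                 ∀ {vs} → Unique vs → All (FactorOfLength n) vs →
                 ∃ λ vs′ → Unique vs′ × All (FactorOfLength (suc n)) vs′ × length vs′ ≡ length zs + length vs
  more-factors {m} {N} {n} {v} {z} {zs} bound N+m≤n n≤v v-factor zs# prefixes vs! vs-factors
    with branches z zs zs#
  ... | es , es! , len , es≼ , es-branch =
    let vs′ , vs′! , vs′-factors , len′ , origins = extend-factors siblings vs! vs-factors in
    map (complete n v) es ++ vs′ ,
    Unique.++⁺ (unique-map inj es-size es!) vs′!
      (λ (x∈es , x∈vs′) → proj₁ (All.lookup origins x∈vs′) x∈es) ,
    All.++⁺ (All.map⁺ (All.zipWith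
      (λ {e} ((0<e , e≤m) , e≼) →
        length-complete v e n≤v 0<e (≤-trans e≤m (≤-trans (m≤n+m m N) (≤-trans N+m≤n (n≤1+n n)))) ,
        factor-complete n v (proj₂ (prefixes e≼)))
      (es-size , es≼))) vs′-factors ,
    trans (length-++ (map (complete n v) es)) (cong₂ _+_ (trans (length-map _ es) len) len′)
    where
    inj : ∀ {e e′} → 0 < length e × length e ≤ m → 0 < length e′ × length e′ ≤ m →
          complete n v e ≡ complete n v e′ → e ≡ e′
    inj = complete-injective bound v-factor N+m≤n n≤v
    0<∷ʳ : ∀ p {c : Fin k} → 0 < length (p ∷ʳ c)
    0<∷ʳ p = subst (0 <_) (sym (length-∷ʳ p)) (s≤s z≤n)
    es-size : All (λ e → 0 < length e × length e ≤ m) es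
    es-size = All.zipWith (λ { ((p , _ , refl , _) , e≼) → 0<∷ʳ p , proj₁ (prefixes e≼) }) (es-branch , es≼)
    -- An unlisted sibling edge stays outside the image of `es`, because completion is injective on
    -- non-empty words of length at most `m`.
    siblings : All (Sibling (map (complete n v) es) (Factor w)) (map (complete n v) es)
    siblings = All.map⁺ (All.map
      (λ { (p , c , refl , c′ , pc′∉ , pc′≼) →
        _ , c , complete-∷ʳ n v p c , c′ ,
        (λ mem → let e , e∈ , eq = ∈-map⁻ (complete n v) mem in
          pc′∉ (subst (_∈ es)
            (sym (inj (0<∷ʳ p , proj₁ (prefixes pc′≼)) (All.lookup es-size e∈)
                      (trans (complete-∷ʳ n v p c′) eq)))
            e∈)) ,
        subst (Factor w) (complete-∷ʳ n v p c′) (factor-complete n v (proj₂ (prefixes pc′≼))) })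
      es-branch)

  -- From constant growth to superlinear complexity.

  -- Growth of `p_w` is put as a property of arbitrary lists of distinct factors, so no complete
  -- list of factors is ever needed.
  GrowsBy : ℕ → ℕ → Set
  GrowsBy s n = ∀ {vs} → Unique vs → All (FactorOfLength n) vs →
    ¬ ¬ ∃ λ vs′ → Unique vs′ × All (FactorOfLength (suc n)) vs′ × length vs′ ≡ s + length vs

  iterate-growth : ∀ {s n₀} → (∀ n → n₀ ≤ n → GrowsBy s n) → ∀ t →
                   ¬ ¬ ∃ λ vs → Unique vs × All (FactorOfLength (t + n₀)) vs × length vs ≡ t * s
  -- The empty list is a sufficient start: what is lost at length `n₀` is a constant.
  iterate-growth         grow zero    ¬vs = ¬vs ([] , [] , [] , refl)
  iterate-growth {s} {n₀} grow (suc t) ¬vs = iterate-growth grow t λ (vs , vs! , vs-factors , len) →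
    grow (t + n₀) (m≤n+m n₀ t) vs! vs-factors λ (vs′ , vs′! , vs′-factors , len′) →
      ¬vs (vs′ , vs′! , vs′-factors , trans len′ (cong (s +_) len))

  growth⇒superlinear : ∀ {C n₀} → (∀ n → n₀ ≤ n → GrowsBy (suc C) n) →
                       ¬ (∀ n → 1 ≤ n → ComplexityAtMost w n (C * n))
  growth⇒superlinear {C} {n₀} grow linear = iterate-growth grow t λ (vs , vs! , vs-factors , len) →
    1+n≰n (+-cancelʳ-≤ (C * t) t (C * n₀) (begin
      t + C * t          ≡⟨ cong (t +_) (*-comm C t) ⟩
      t + t * C          ≡⟨ *-suc t C ⟨
      t * suc C          ≡⟨ len ⟨
      length vs          ≤⟨ linear (t + n₀) (s≤s z≤n) vs vs! vs-factors ⟩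
      C * (t + n₀)       ≡⟨ *-distribˡ-+ C t n₀ ⟩
      C * t + C * n₀     ≡⟨ +-comm (C * t) (C * n₀) ⟩
      C * n₀ + C * t     ∎))
    where
    open ≤-Reasoning
    -- The least `t` for which `t * suc C` exceeds `C * (t + n₀)`.
    t = suc (C * n₀)

  -- Incomparable words and the choice of family members.

  -- If `b = a ++ q` with `q` non-empty, then `v` would be a prefix of `q ++ v` and have the short
  -- period `length q`. If `a` is the longer word, the lengths already conflict.
  ++-incomparable : ∀ {M N a b v} → PeriodBound M N → Factor w v → N ≤ length v →
                    length a ≤ M → length b ≤ M → a ≢ b → ¬ a ++ v ≼ b ++ v
  ++-incomparable {a = a} {b} {v} bound v-factor N≤v a≤M b≤M a≢b av≼bv
    with ≼⇒++ av≼bv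
  ... | t , eq with trans (sym (++-assoc a v t)) eq | ≤-total (length a) (length b)
  ...   | eq′ | inj₁ a≤b with ++-split a b eq′ a≤b
  ...     | []      , a≡b , _ = a≢b (trans (sym (++-identityʳ a)) a≡b)
  ...     | q@(_ ∷ _) , refl , vt≡qv =
    bound v-factor N≤v (s≤s z≤n) (≤-trans (≤-trans (m≤n+m (length q) (length a)) (≤-reflexive (sym (length-++ a)))) b≤M) vt≡qv
  ++-incomparable {a = a} {b} {v} bound v-factor N≤v a≤M b≤M a≢b av≼bv
      | t , eq | eq′ | inj₂ b≤a with ++-split b a (sym eq′) b≤a
  ...     | []      , b≡a , _ = a≢b (trans (sym b≡a) (++-identityʳ b))
  ...     | q@(_ ∷ _) , _ , v≡qvt = <-irrefl (cong length v≡qvt) (begin-strict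
    length v                                <⟨ s≤s (m≤m+n (length v) (length t)) ⟩
    suc (length v + length t)               ≤⟨ +-monoˡ-≤ (length v + length t) {1} {length q} (s≤s z≤n) ⟩
    length q + (length v + length t)        ≡⟨ cong (length q +_) (length-++ v) ⟨
    length q + length (v ++ t)              ≡⟨ length-++ q ⟨
    length (q ++ v ++ t)                    ∎)
    where open ≤-Reasoning

upper-bound : ∀ (f : ℕ → ℕ) n → ∃ λ m → ∀ {i} → i < n → f i ≤ m
upper-bound f zero    = 0 , λ ()
upper-bound f (suc n) with upper-bound f n
... | m , f≤m = f n ⊔ m , λ {i} i<1+n → bound i (m≤n⇒m<n∨m≡n (≤-pred i<1+n))
  where
  bound : ∀ i → i < n ⊎ i ≡ n → f i ≤ f n ⊔ m
  bound i (inj₁ i<n)  = ≤-trans (f≤m i<n) (m≤n⊔m (f n) m)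
  bound i (inj₂ refl) = m≤m⊔n (f n) m

theorem1 : (k : ℕ) (w : Word k) → UniformlyRecurrent w →
    (u : ℕ → FinWord k) →
    Injective _≡_ _≡_ u →
    (∀ n → ¬ (u n ≡ [])) →
    (∀ n → Factor w (u n)) →
    (∀ (vs : List (FinWord k)) → Unique vs → All (InFamily u) vs →
    Factor w (concat vs)) →
    ¬ Periodic w → ¬ LinearComplexity w
theorem1 k w rec u u-inj _ u-factor u-concat ¬per (C , linear) =
  periodBound w rec ¬per M λ (N , boundM) →
  -- Starting at index `D` keeps `u j` different from the first `D` members; length `N` makes the
  -- words `z i` incomparable.
  long-word u u-inj D N λ (j , D≤j , N≤uj) →
  let z : ℕ → FinWord k
      z i = u i ++ u j
      m , z≤m = upper-bound (length ∘ z) D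
      incomparable : ∀ {a b} → a < D → b < D → a ≢ b → ¬ z a ≼ z b
      incomparable a<D b<D a≢b =
        ++-incomparable w boundM (u-factor j) N≤uj (u≤M a<D) (u≤M b<D) (a≢b ∘ u-inj)
  -- A second period bound is required, since the branchings lie at depth up to `m`, which depends
  -- on `u j`.
  in periodBound w rec ¬per m λ (N′ , boundm) →
     growth⇒superlinear w {C} {N′ + m} (λ n N′+m≤n {vs} vs! vs-factors ¬vs′ →
       -- With `l > j > i` the three members are distinct, so the hypothesis on concatenations
       -- applies to `u l`, `u i`, `u j`.
       long-word u u-inj (suc j) n λ (l , j<l , n≤ul) →
       let prefixes : ∀ {e} → PrefixOfSome (applyUpTo z D) e → length e ≤ m × Factor w (u l ++ e)
           prefixes {e} e≼ =
             let i , i<D , e≼zi = Any.applyUpTo⁻ z e≼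
                 t , et≡zi = ≼⇒++ e≼zi
                 i<j = ≤-trans i<D D≤j
                 vzi-factor : Factor w (u l ++ u i ++ u j ++ [])
                 vzi-factor = u-concat (u l ∷ u i ∷ u j ∷ [])
                   (((<⇒≢ (<-trans i<j j<l) ∘ sym ∘ u-inj) ∷ (<⇒≢ j<l ∘ sym ∘ u-inj) ∷ []) ∷ ((<⇒≢ i<j ∘ u-inj) ∷ []) ∷ [] ∷ [])
                   ((l , refl) ∷ (i , refl) ∷ (j , refl) ∷ [])
             in ≤-trans (m≤m+n (length e) (length t)) (≤-trans (≤-reflexive (trans (sym (length-++ e)) (cong length et≡zi))) (z≤m i<D)) ,
                proj₁ (factor-++⁻ w (u l ++ e) {t} (subst (Factor w)
                  (trans (cong (u l ++_) (trans (cong (u i ++_) (++-identityʳ (u j))) (sym et≡zi))) (sym (++-assoc (u l) e t)))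
                  vzi-factor))
           vs′ , vs′! , vs′-factors , len = more-factors w boundm N′+m≤n n≤ul (u-factor l)
             (AllPairs.applyUpTo⁺₁ z D λ a<b b<D →
               incomparable (<-trans a<b b<D) b<D (<⇒≢ a<b) , incomparable b<D (<-trans a<b b<D) (<⇒≢ a<b ∘ sym))
             prefixes vs! vs-factors
       in ¬vs′ (vs′ , vs′! , vs′-factors , trans len (cong (_+ length vs) (length-applyUpTo (z ∘ suc) (suc C)))))
     linear
  where
  -- `D` words give `suc C` branchings, one more than the assumed slope `C`.
  D = 2 + C
  M = proj₁ (upper-bound (length ∘ u) D)
  u≤M : ∀ {i} → i < D → length (u i) ≤ M
  u≤M = proj₂ (upper-bound (length ∘ u) D)
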